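{- Let $\kappa(n, m, r)$ denote the maximum of $|\mathcal{K}^m(T)|$ over all labeled graphs $(G, L, f)$ with $|L| \leq r$ and over all sets of terminals $T = \{v_1, v_2, \ldots, v_n\} \subseteq V(G)$, i.e., the maximum number of distinct cut characteristics induced by separators of at most $m$ vertices in an $n$-terminal graph labeled with $r$ different labels. Then $$\kappa(n, m, r) \in \mathcal{O}\left(m^{2n} \cdot r^{nm(m+3)/2} \cdot 4^{nm}\right),$$ which is polynomial in $r$ for fixed $n, m$.
   Context: All graphs are simple, undirected and finite. A labeled graph is a tuple $(G, L, f)$ where $G$ is a graph, $L$ is a finite set of labels, and $f \colon V(G) \to 2^L$ assigns to each vertex a (possibly empty) subset of the labels. For $S \subseteq V(G)$ and a terminal $t \in V(G)$, $R(t, S)$ denotes the set of vertices of $V(G) \setminus S$ reachable from $t$ in $G - S$ (empty if $t\in S$), and $\mathcal{L}(t, S) := \bigcup_{v \in R(t, S)} f(v)$ is the set of labels reachable from $t$ in $G-S$. For a sequence $T = t_1, \ldots, t_n$ of distinct terminal vertices in $G$ (a set of terminals is ordered arbitrarily), the cut characteristic of $S \subseteq V(G)$ with respect to $T$ is the vector $\mathcal{K}(S, T) := (\mathcal{L}(t_1, S), \mathcal{L}(t_2, S), \ldots, \mathcal{L}(t_n, S))$. For $m\geq 1$, $\mathcal{K}^m(T) := \{ \mathcal{K}(S, T) \mid S \subseteq V(G), |S|\leq m \}$. -}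

module Defs where

open import Data.Bool.Base using (true; false)
open import Data.Bool.Properties as Bool using ()
open import Data.Empty using (⊥)
open import Data.Fin.Base using (Fin)
open import Data.Fin.Properties using (any?; injective⇒≤)
open import Data.Fin.Subset using (Subset; inside; outside; _∈_; _∉_; ⁅_⁆; _∪_; ∣_∣; _⊃_)
open import Data.Fin.Subset.Induction using (⊃-wellFounded; Acc; acc)
open import Data.Fin.Subset.Properties
  using (_∈?_; x∈⁅x⁆; x∈⁅y⁆⇒x≡y; p⊆p∪q; q⊆p∪q; x∈p∪q⁻)
open import Data.List.Base as List using (List; []; _∷_; foldr; length; filter; deduplicate; cartesianProductWith)
open import Data.List.Membership.Propositional using () renaming (_∈_ to _∈ˡ_)
open import Data.List.Membership.Propositional.Properties as ∈ˡ using ()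
open import Data.List.Properties using (length-++; length-map)
open import Data.List.Relation.Unary.All as All using ()
open import Data.List.Relation.Unary.Any as Any using (here; there)
open import Data.List.Relation.Unary.Any.Properties using (lookup-index)
open import Data.List.Relation.Unary.Unique.DecPropositional.Properties using (deduplicate-!)
open import Data.List.Relation.Unary.Unique.Propositional using (Unique; _∷_)
open import Data.Nat.Base using (ℕ; zero; suc; _+_; _*_; _^_; _/_; _≤_; z≤n; s≤s⁻¹)
open import Data.Nat.Properties using (_≤?_; ≤-trans; ≤-reflexive; ≤-antisym; ≤∧≢⇒<; ^-monoˡ-≤; ^-monoʳ-≤)
open import Data.Product.Base using (Σ; ∃; ∃-syntax; _×_; _,_; proj₁; proj₂)
open import Data.Sum.Base using (inj₁; inj₂)
open import Data.Vec.Base as Vec using (Vec; []; _∷_; tabulate)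
open import Data.Vec.Properties using (≡-dec)
open import Data.Vec.Relation.Unary.Unique.Propositional using () renaming (Unique to Distinct)
import Data.Vec.Relation.Unary.Unique.Propositional.Properties as Distinctᵛ
open import Function.Base using (id)
open import Function.Bundles using (_⇔_; mk⇔)
open import Level using (0ℓ)
open import Relation.Binary.Construct.Closure.ReflexiveTransitive using (Star; ε; _◅_; _◅◅_)
open import Relation.Binary.Core using (Rel)
open import Relation.Binary.Definitions using (Symmetric; Irreflexive; Decidable)
open import Relation.Binary.PropositionalEquality using (_≡_; refl; sym; trans; cong; cong₂; subst)
open import Relation.Nullary using (¬_; Dec; yes; no; does; contradiction; ¬?; _×-dec_)
open import Relation.Nullary.Decidable using (map′)
open import Relation.Unary using (Pred)

record Graph : Set₁ where
  field
    order   : ℕ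
    _~_     : Rel (Fin order) 0ℓ
    ~-sym   : Symmetric _~_
    ~-irrefl : Irreflexive _≡_ _~_
    _~?_    : Decidable _~_

  Vertex : Set
  Vertex = Fin order

record LabeledGraph : Set₁ where
  field
    graph : Graph
  open Graph graph public
  field
    #labels : ℕ
    f       : Vertex → Subset #labels

  Label : Set
  Label = Fin #labels

Star? : ∀ {n} {_⟶_ : Rel (Fin n) 0ℓ} → Decidable _⟶_ → Decidable (Star _⟶_)
Star? {n} {_⟶_} _⟶?_ s v
  with close ⁅ s ⁆ (⊃-wellFounded _) (x∈⁅x⁆ s)
         (λ x∈ → subst (Star _⟶_ s) (sym (x∈⁅y⁆⇒x≡y s x∈)) ε)
  where
  
  Closed : Subset n → Set
  Closed A = ∀ {u w} → u ∈ A → u ⟶ w → w ∈ A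

  close : ∀ A → Acc _⊃_ A → s ∈ A → (∀ {u} → u ∈ A → Star _⟶_ s u) →
          ∃[ B ] (s ∈ B × (∀ {u} → u ∈ B → Star _⟶_ s u) × Closed B)
  close A (acc rec) s∈A sound
    with any? (λ u → any? (λ w → (u ∈? A) ×-dec ((u ⟶? w) ×-dec ¬? (w ∈? A))))
  ... | yes (u , w , u∈A , u⟶w , w∉A) =
    close (A ∪ ⁅ w ⁆)
      (rec (p⊆p∪q ⁅ w ⁆ , w , q⊆p∪q A ⁅ w ⁆ (x∈⁅x⁆ w) , w∉A))
      (p⊆p∪q ⁅ w ⁆ s∈A) sound′
    where
    sound′ : ∀ {x} → x ∈ A ∪ ⁅ w ⁆ → Star _⟶_ s x
    sound′ x∈ with x∈p∪q⁻ A ⁅ w ⁆ x∈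
    ... | inj₁ x∈A = sound x∈A
    ... | inj₂ x∈w with refl ← x∈⁅y⁆⇒x≡y w x∈w = sound u∈A ◅◅ (u⟶w ◅ ε)
  ... | no none = A , s∈A , sound , closed
    where
    closed : Closed A
    closed {u} {w} u∈A u⟶w with w ∈? A
    ... | yes w∈A = w∈A
    ... | no  w∉A = contradiction (u , w , u∈A , u⟶w , w∉A) none
... | B , s∈B , sound , closed = map′ sound (complete s∈B) (v ∈? B)
  where
  complete : ∀ {u v} → u ∈ B → Star _⟶_ u v → v ∈ B
  complete u∈B ε        = u∈B
  complete u∈B (e ◅ es) = complete (closed u∈B e) es

module _ (G : LabeledGraph) where
  open LabeledGraph G

  -- Adjacency in G − S.
  Adj∖ : Subset order → Rel Vertex 0ℓ
  Adj∖ S u w = u ∉ S × w ∉ S × u ~ w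

  -- R t S v means v ∈ R(t, S).  The requirement t ∉ S is needed because
  -- Star is reflexive at every vertex, deleted ones included.
  R : Vertex → Subset order → Pred Vertex 0ℓ
  R t S v = t ∉ S × v ∉ S × Star (Adj∖ S) t v

  Adj∖? : ∀ S → Decidable (Adj∖ S)
  Adj∖? S u w = ¬? (u ∈? S) ×-dec (¬? (w ∈? S) ×-dec (u ~? w))

  R? : ∀ t S v → Dec (R t S v)
  R? t S v = ¬? (t ∈? S) ×-dec (¬? (v ∈? S) ×-dec Star? (Adj∖? S) t v)

  ℒ : Vertex → Subset order → Subset #labels
  ℒ t S = tabulate λ x → does (any? λ v → R? t S v ×-dec (x ∈? f v))

  𝒦 : ∀ {n} → Subset order → Vec Vertex n → Vec (Subset #labels) n
  𝒦 S T = Vec.map (λ t → ℒ t S) T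

  𝒦^ : ∀ {n} → ℕ → Vec Vertex n → Pred (Vec (Subset #labels) n) 0ℓ
  𝒦^ m T χ = ∃[ S ] (∣ S ∣ ≤ m × 𝒦 S T ≡ χ)

HasCardinality : {A : Set} → Pred A 0ℓ → ℕ → Set
HasCardinality {A} P k =
  Σ (List A) λ xs → Unique xs × (∀ x → x ∈ˡ xs ⇔ P x) × length xs ≡ k

CharacteristicCount : ℕ → ℕ → ℕ → ℕ → Set₁
CharacteristicCount n m r c =
  Σ LabeledGraph λ G → let open LabeledGraph G in
    #labels ≤ r ×
    Σ (Vec Vertex n) λ T → Distinct T × HasCardinality (𝒦^ G m T) c

IsMaximum : ∀ {a} → Pred ℕ a → Pred ℕ a
IsMaximum P k = P k × (∀ j → P j → j ≤ k)

-- κ n m r k means κ(n, m, r) = k.  The maximum ranges over infinitely many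
-- labeled graphs, so it is a functional relation rather than a computed value:
-- see κ-unique, and κ-exists for (double-negated) existence.
κ : ℕ → ℕ → ℕ → ℕ → Set₁
κ n m r = IsMaximum (CharacteristicCount n m r)

κ-bound : ℕ → ℕ → ℕ → ℕ
κ-bound n m r = m ^ (2 * n) * r ^ (n * m * (m + 3) / 2) * 4 ^ (n * m)

-- The polynomial with the given coefficients, constant term first.
evalPoly : List ℕ → ℕ → ℕ
evalPoly p x = foldr (λ a y → a + x * y) 0 p

IsPolynomial : (ℕ → ℕ) → Set
IsPolynomial g = ∃[ p ] (∀ x → g x ≡ evalPoly p x)

κ-unique : ∀ {n m r k k′} → κ n m r k → κ n m r k′ → k ≡ k′
κ-unique (c , max) (c′ , max′) = ≤-antisym (max′ _ c) (max _ c′)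

vecs : {A : Set} → List A → ∀ n → List (Vec A n)
vecs xs zero    = [] ∷ []
vecs xs (suc n) = cartesianProductWith _∷_ xs (vecs xs n)

length-cpw : {A B C : Set} (g : A → B → C) (xs : List A) (ys : List B) →
             length (cartesianProductWith g xs ys) ≡ length xs * length ys
length-cpw g []       ys = refl
length-cpw g (x ∷ xs) ys =
  trans (length-++ (List.map (g x) ys))
        (cong₂ _+_ (length-map (g x) ys) (length-cpw g xs ys))

length-vecs : {A : Set} (xs : List A) → ∀ n → length (vecs xs n) ≡ length xs ^ n
length-vecs xs zero    = refl
length-vecs xs (suc n) =
  trans (length-cpw _∷_ xs (vecs xs n))
        (cong (length xs *_) (length-vecs xs n))

vecs-complete : {A : Set} {xs : List A} → (∀ x → x ∈ˡ xs) →
                ∀ {n} (v : Vec A n) → v ∈ˡ vecs xs n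
vecs-complete all []      = here refl
vecs-complete all (x ∷ v) =
  ∈ˡ.∈-cartesianProductWith⁺ _∷_ (all x) (vecs-complete all v)

subsets : ∀ n → List (Subset n)
subsets = vecs (inside ∷ outside ∷ [])

subsets-complete : ∀ {n} (S : Subset n) → S ∈ˡ subsets n
subsets-complete = vecs-complete λ { true → here refl ; false → there (here refl) }

lookup-injective : {A : Set} {xs : List A} → Unique xs → ∀ i j →
                   List.lookup xs i ≡ List.lookup xs j → i ≡ j
lookup-injective (x∉ ∷ u) Fin.zero    Fin.zero    eq = refl
lookup-injective (x∉ ∷ u) Fin.zero    (Fin.suc j) eq = contradiction eq (All.lookup x∉ (∈ˡ.∈-lookup j))
lookup-injective (x∉ ∷ u) (Fin.suc i) Fin.zero    eq = contradiction (sym eq) (All.lookup x∉ (∈ˡ.∈-lookup i))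
lookup-injective (x∉ ∷ u) (Fin.suc i) (Fin.suc j) eq = cong Fin.suc (lookup-injective u i j eq)

length-unique-≤ : {A : Set} {xs ys : List A} → Unique xs → (∀ x → x ∈ˡ ys) → length xs ≤ length ys
length-unique-≤ {xs = xs} {ys} u all = injective⇒≤ {f = λ i → Any.index (all (List.lookup xs i))}
  λ {i} {j} eq → lookup-injective u i j
    (trans (lookup-index (all _))
      (trans (cong (List.lookup ys) eq) (sym (lookup-index (all _)))))

count-≤ : ∀ {n m r} c → CharacteristicCount n m r c → c ≤ (2 ^ r) ^ n
count-≤ {n} {m} {r} _ (G , l≤r , T , _ , xs , u , _ , refl) =
  ≤-trans (length-unique-≤ u (vecs-complete subsets-complete))
    (≤-trans (≤-reflexive (trans (length-vecs (subsets l) n) (cong (_^ n) (length-vecs _ l))))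
      (^-monoˡ-≤ n (^-monoʳ-≤ 2 l≤r)))
  where l = LabeledGraph.#labels G

𝒦^-finite : ∀ G {n} m (T : Vec (LabeledGraph.Vertex G) n) → ∃[ c ] HasCardinality (𝒦^ G m T) c
𝒦^-finite G {n} m T = length xs , xs , deduplicate-! _≟_ _ , (λ χ → mk⇔ to from) , refl
  where
  _≟_ = ≡-dec {n = n} (≡-dec {n = LabeledGraph.#labels G} Bool._≟_)
  small = filter (λ S → ∣ S ∣ ≤? m) (subsets (LabeledGraph.order G))
  xs = deduplicate _≟_ (List.map (λ S → 𝒦 G S T) small)

  to : ∀ {χ} → χ ∈ˡ xs → 𝒦^ G m T χ
  to χ∈ with ∈ˡ.∈-map⁻ _ (∈ˡ.∈-deduplicate⁻ _≟_ _ χ∈)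
  ... | S , S∈ , eq = S , proj₂ (∈ˡ.∈-filter⁻ (λ S → ∣ S ∣ ≤? m) {xs = subsets _} S∈) , sym eq

  from : ∀ {χ} → 𝒦^ G m T χ → χ ∈ˡ xs
  from (S , le , refl) = ∈ˡ.∈-deduplicate⁺ _≟_
    (∈ˡ.∈-map⁺ _ (∈ˡ.∈-filter⁺ (λ S → ∣ S ∣ ≤? m) (subsets-complete S) le))

count-inhabited : ∀ n m r → ∃ (CharacteristicCount n m r)
count-inhabited n m r = let c , card = 𝒦^-finite G m T in
  c , G , z≤n , T , Distinctᵛ.tabulate⁺ id , card
  where
  G : LabeledGraph
  G = record
    { graph = record
      { order = n ; _~_ = λ _ _ → ⊥ ; ~-sym = id ; ~-irrefl = λ _ → id ; _~?_ = λ _ _ → no id }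
    ; #labels = 0 ; f = λ _ → [] }
  T = tabulate id

bounded⇒maximum : ∀ {a} {P : Pred ℕ a} b → (∀ j → P j → j ≤ b) → ∃ P → ¬ ¬ ∃ (IsMaximum P)
bounded⇒maximum {P = P} zero    le (j , p) none = none (j , p , λ i q → ≤-trans (le i q) z≤n)
bounded⇒maximum {P = P} (suc b) le inh     none = bounded⇒maximum b
  (λ j p → s≤s⁻¹ (≤∧≢⇒< (le j p) λ j≡ → none (suc b , subst P j≡ p , le)))
  inh none

κ-exists : ∀ n m r → ¬ ¬ ∃ (κ n m r)
κ-exists n m r = bounded⇒maximum ((2 ^ r) ^ n) count-≤ (count-inhabited n m r)

{-# OPTIONS --safe #-}

-- The count is at most the product over the terminals of the number of sets ℒ(t, S), so it
-- suffices to show that one terminal sees at most 4^m r^(2m) label sets.  Let X be the set of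
-- labels cut off by S.  Pushing S towards X, one may assume that S = N(A), where A ∋ t is
-- connected, avoids X, and every larger connected set avoiding X has a larger neighbourhood
-- (S is an important separator).  By submodularity of ∣N∣, the size of a minimum cut grows by
-- adding single labels: at most ∣S∣ labels of X already force cuts around A of size ∣S∣, and
-- one further label for each v ∈ S forces size ∣S∣ + 1 once v joins A.  Hence A is already
-- important for some 2m labels of X, and by the usual branching argument a list of labels
-- whose minimum cut is nonempty has at most 2^(2m−1) important separators of size at most m.
module Submission where

open import Defs
open import Data.Nat.Base using (ℕ; _*_; _≤_)
open import Data.Product.Base using (∃-syntax; _×_)

open import Data.Empty using (⊥-elim) renaming (⊥ to Empty)
open import Data.Fin.Base using (Fin; zero; suc)
open import Data.Fin.Properties using (any?; injective⇒≤)
open import Data.Fin.Subset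
  using (Subset; inside; outside; _∈_; _∉_; _⊆_; ⁅_⁆; _∪_; _∩_; ∣_∣; _⊃_; ⊥; ⊤)
open import Data.Fin.Subset.Induction using (⊃-wellFounded; Acc; acc)
open import Data.Fin.Subset.Properties
  using (_∈?_; _⊆?_; anySubset?; x∈⁅x⁆; x∈⁅y⁆⇒x≡y; p⊆p∪q; q⊆p∪q; x∈p∪q⁻; x∈p∩q⁺; p∩q⊆p; p∩q⊆q;
         ⊆-antisym; ⊆-refl; ∉⊥; ∈⊤; ∣⊥∣≡0; ∣⁅x⁆∣≡1; p⊆q⇒∣p∣≤∣q∣; p⊂q⇒∣p∣<∣q∣; ∣p∣≤∣p∪q∣; ∪-identityʳ)
open import Data.List.Base as List
  using (List; []; _∷_; _++_; length; concatMap; cartesianProductWith; filter; allFin; replicate)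
open import Data.List.Membership.Propositional using () renaming (_∈_ to _∈ˡ_)
open import Data.List.Membership.Propositional.Properties
  using (∈-lookup; ∈-allFin; ∈-filter⁺; ∈-++⁺ˡ; ∈-++⁺ʳ; ∈-++⁻; ∈-map⁺; ∈-concatMap⁺; ∈-cartesianProductWith⁺)
open import Data.List.Properties using (length-++; length-map; length-tabulate)
open import Data.List.Relation.Binary.Subset.Propositional using () renaming (_⊆_ to _⊆ˡ_)
import Data.List.Relation.Binary.Subset.Propositional.Properties as ⊆ˡ
open import Data.List.Relation.Unary.All as All using (All; []; _∷_)
open import Data.List.Relation.Unary.All.Properties using (all-filter)
open import Data.List.Relation.Unary.Any as Any using (here; there)
open import Data.List.Relation.Unary.Any.Properties using (lookup-index)
open import Data.List.Relation.Unary.Unique.Propositional using (Unique)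
open import Data.Nat.Base using (zero; suc; _+_; _^_; _/_; _<_; _∸_; z≤n; s≤s; >-nonZero)
open import Data.Nat.DivMod using (/-monoˡ-≤; m*n/n≡m)
open import Data.Nat.Properties hiding (_≟_)
open import Data.Nat.Solver using (module +-*-Solver)
open import Data.Product.Base using (∃; _,_; proj₁; proj₂)
open import Data.Sum.Base using (_⊎_; inj₁; inj₂; [_,_]′)
open import Data.Vec.Base as Vec using (Vec; []; _∷_; tabulate; lookup; toList)
open import Data.Vec.Properties using (lookup∘tabulate; lookup⇒[]=; []=⇒lookup)
open import Function.Base using (_∘_; id; case_of_)
open import Function.Bundles using (Equivalence)
open import Level using (0ℓ)
open import Relation.Binary.Construct.Closure.ReflexiveTransitive using (Star; ε; _◅_; _◅◅_)
open import Relation.Binary.PropositionalEquality using (_≡_; refl; sym; trans; cong; cong₂; subst)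
open import Relation.Nullary using (¬_; Dec; yes; no; does; contradiction; ¬?; _×-dec_)
open import Relation.Nullary.Decidable using (dec-true; decidable-stable)
open import Relation.Unary using (Pred; Decidable)

-- Sizes of subsets and lists.

module _ {n} {P : Pred (Fin n) 0ℓ} (P? : Decidable P) where

  ⟦_⟧ : Subset n
  ⟦_⟧ = tabulate (does ∘ P?)

  ∈⟦⟧⁺ : ∀ {i} → P i → i ∈ ⟦_⟧
  ∈⟦⟧⁺ {i} p = lookup⇒[]= i _ (trans (lookup∘tabulate _ i) (dec-true (P? i) p))

  ∈⟦⟧⁻ : ∀ {i} → i ∈ ⟦_⟧ → P i
  ∈⟦⟧⁻ {i} i∈ with P? i | trans (sym (lookup∘tabulate (does ∘ P?) i)) ([]=⇒lookup i∈)
  ... | yes p | _ = p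

∪-lub : ∀ {n} {A B C : Subset n} → A ⊆ C → B ⊆ C → A ∪ B ⊆ C
∪-lub A⊆C B⊆C x∈ with x∈p∪q⁻ _ _ x∈
... | inj₁ x∈A = A⊆C x∈A
... | inj₂ x∈B = B⊆C x∈B

⁅⁆⊆ : ∀ {n} {v : Fin n} {A} → v ∈ A → ⁅ v ⁆ ⊆ A
⁅⁆⊆ {v = v} v∈A x∈ with refl ← x∈⁅y⁆⇒x≡y v x∈ = v∈A

∪⁅⁆-⊃ : ∀ {n} {v : Fin n} {A} → v ∉ A → (A ∪ ⁅ v ⁆) ⊃ A
∪⁅⁆-⊃ {v = v} {A} v∉A = p⊆p∪q ⁅ v ⁆ , v , q⊆p∪q A ⁅ v ⁆ (x∈⁅x⁆ v) , v∉A

∣∪∣+∣∩∣ : ∀ {n} (p q : Subset n) → ∣ p ∪ q ∣ + ∣ p ∩ q ∣ ≡ ∣ p ∣ + ∣ q ∣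
∣∪∣+∣∩∣ []            []            = refl
∣∪∣+∣∩∣ (inside  ∷ p) (inside  ∷ q) =
  cong suc (trans (+-suc _ _) (trans (cong suc (∣∪∣+∣∩∣ p q)) (sym (+-suc _ _))))
∣∪∣+∣∩∣ (inside  ∷ p) (outside ∷ q) = cong suc (∣∪∣+∣∩∣ p q)
∣∪∣+∣∩∣ (outside ∷ p) (inside  ∷ q) = trans (cong suc (∣∪∣+∣∩∣ p q)) (sym (+-suc _ _))
∣∪∣+∣∩∣ (outside ∷ p) (outside ∷ q) = ∣∪∣+∣∩∣ p q

-- Inclusion-exclusion reduces a comparison of sums of sizes to two inclusions.
∣∣+∣∣-mono : ∀ {n} {p q p′ q′ : Subset n} → p ∪ q ⊆ p′ ∪ q′ → p ∩ q ⊆ p′ ∩ q′ →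
             ∣ p ∣ + ∣ q ∣ ≤ ∣ p′ ∣ + ∣ q′ ∣
∣∣+∣∣-mono {p = p} {q} {p′} {q′} ∪⊆ ∩⊆ = begin
  ∣ p ∣ + ∣ q ∣            ≡⟨ ∣∪∣+∣∩∣ p q ⟨
  ∣ p ∪ q ∣ + ∣ p ∩ q ∣     ≤⟨ +-mono-≤ (p⊆q⇒∣p∣≤∣q∣ ∪⊆) (p⊆q⇒∣p∣≤∣q∣ ∩⊆) ⟩
  ∣ p′ ∪ q′ ∣ + ∣ p′ ∩ q′ ∣ ≡⟨ ∣∪∣+∣∩∣ p′ q′ ⟩
  ∣ p′ ∣ + ∣ q′ ∣          ∎
  where open ≤-Reasoning

++-lub : ∀ {A : Set} {xs ys zs : List A} → xs ⊆ˡ zs → ys ⊆ˡ zs → xs ++ ys ⊆ˡ zs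
++-lub {xs = xs} xs⊆ ys⊆ x∈ = [ xs⊆ , ys⊆ ]′ (∈-++⁻ xs x∈)

-- Lets the choices made separately at each vertex of a cut share one list, no longer than the cut
-- is large.
collect : ∀ {n} {A : Set} {X : List A} (S : Subset n) {P : Fin n → List A → Set} →
          (∀ {v} → v ∈ S → ∃[ ys ] (length ys ≤ 1 × ys ⊆ˡ X × P v ys)) →
          ∃[ zs ] (length zs ≤ ∣ S ∣ × zs ⊆ˡ X × (∀ {v} → v ∈ S → ∃[ ys ] (ys ⊆ˡ zs × P v ys)))
collect []            _ = [] , z≤n , (λ ()) , λ ()
collect (outside ∷ S) pick with collect S (pick ∘ Vec.there)
... | zs , len , zs⊆ , found = zs , len , zs⊆ , λ { (Vec.there v∈) → found v∈ }
collect (inside ∷ S) pick with collect S (pick ∘ Vec.there) | pick Vec.here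
... | zs , len , zs⊆ , found | ys , len′ , ys⊆ , p =
  ys ++ zs ,
  ≤-trans (≤-reflexive (length-++ ys)) (+-mono-≤ len′ len) ,
  ++-lub ys⊆ zs⊆ ,
  λ { Vec.here        → ys , ∈-++⁺ˡ , p
    ; (Vec.there v∈) → let ws , ws⊆ , q = found v∈ in ws , (∈-++⁺ʳ ys ∘ ws⊆) , q }

-- Gives short lists a common length, so that `vecs` can enumerate them. Filling up with an element
-- of `X` keeps the result inside `X`.
pad : ∀ {A : Set} {X : List A} {x} → x ∈ˡ X → ∀ k (ys : List A) → ys ⊆ˡ X → length ys ≤ k →
      ∃[ v ] (ys ⊆ˡ toList {n = k} v × toList v ⊆ˡ X)
pad x∈ zero    []       _   _   = [] , id , λ ()
pad {x = x} x∈ (suc k) [] ys⊆ len with pad x∈ k [] ys⊆ z≤n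
... | v , _ , v⊆ = x ∷ v , (λ ()) , λ { (here refl) → x∈ ; (there y∈) → v⊆ y∈ }
pad x∈ (suc k) (y ∷ ys) ys⊆ (s≤s len) with pad x∈ k ys (ys⊆ ∘ there) len
... | v , ⊆v , v⊆ = y ∷ v , (λ { (here eq) → here eq ; (there z∈) → there (⊆v z∈) }) ,
                    λ { (here refl) → ys⊆ (here refl) ; (there z∈) → v⊆ z∈ }

length-concatMap-≤ : ∀ {A B : Set} {b} (g : A → List B) → (∀ x → length (g x) ≤ b) →
                     ∀ xs → length (concatMap g xs) ≤ length xs * b
length-concatMap-≤ g g≤ []       = z≤n
length-concatMap-≤ g g≤ (x ∷ xs) =
  ≤-trans (≤-reflexive (length-++ (g x))) (+-mono-≤ (g≤ x) (length-concatMap-≤ g g≤ xs))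

unique-⊆⇒length-≤ : ∀ {A : Set} {xs ys : List A} → Unique xs → xs ⊆ˡ ys → length xs ≤ length ys
unique-⊆⇒length-≤ {xs = xs} {ys} u xs⊆ = injective⇒≤ {f = λ i → Any.index (xs⊆ (∈-lookup {xs = xs} i))}
  λ {i} {j} eq → lookup-injective u i j
    (trans (lookup-index (xs⊆ (∈-lookup i)))
      (trans (cong (List.lookup ys) eq) (sym (lookup-index (xs⊆ (∈-lookup j))))))

module _ (G : LabeledGraph) where
  open LabeledGraph G

  -- Neighbourhoods and their submodularity.

  Bordering : Subset order → Pred Vertex 0ℓ
  Bordering A v = v ∉ A × ∃[ u ] (u ∈ A × u ~ v)

  bordering? : ∀ A → Decidable (Bordering A)
  bordering? A v = ¬? (v ∈? A) ×-dec any? λ u → (u ∈? A) ×-dec (u ~? v)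

  N : Subset order → Subset order
  N A = ⟦ bordering? A ⟧

  ∈N⁺ : ∀ {A u v} → v ∉ A → u ∈ A → u ~ v → v ∈ N A
  ∈N⁺ {A} v∉A u∈A u~v = ∈⟦⟧⁺ (bordering? A) (v∉A , _ , u∈A , u~v)

  ∈N⁻ : ∀ {A v} → v ∈ N A → Bordering A v
  ∈N⁻ {A} = ∈⟦⟧⁻ (bordering? A)

  -- A vertex of `N (A ∪ B)` or `N (A ∩ B)` lies in `N A` or `N B`, and a vertex of both lies in
  -- both. Adding a fixed `D` to every term preserves this; in the enumeration `D` holds the
  -- vertices committed to the separator.
  N∪-submodular : ∀ A B D → ∣ N (A ∪ B) ∪ D ∣ + ∣ N (A ∩ B) ∪ D ∣ ≤ ∣ N A ∪ D ∣ + ∣ N B ∪ D ∣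
  N∪-submodular A B D = ∣∣+∣∣-mono ∪⊆ ∩⊆
    where
    NA = N A ∪ D
    NB = N B ∪ D
    inA : N A ⊆ NA
    inA = p⊆p∪q D
    inB : N B ⊆ NB
    inB = p⊆p∪q D
    D⇒ : ∀ {x} → x ∈ D → x ∈ NA ∩ NB
    D⇒ x∈D = x∈p∩q⁺ (q⊆p∪q (N A) D x∈D , q⊆p∪q (N B) D x∈D)
    N∪ : N (A ∪ B) ⊆ NA ∪ NB
    N∪ x∈ with ∈N⁻ x∈
    ... | x∉ , u , u∈ , u~x with x∈p∪q⁻ A B u∈
    ... | inj₁ u∈A = p⊆p∪q NB (inA (∈N⁺ (x∉ ∘ p⊆p∪q B) u∈A u~x))
    ... | inj₂ u∈B = q⊆p∪q NA NB (inB (∈N⁺ (x∉ ∘ q⊆p∪q A B) u∈B u~x))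
    N∩ : N (A ∩ B) ⊆ NA ∪ NB
    N∩ {x} x∈ with ∈N⁻ x∈ | x ∈? A
    ... | x∉ , u , u∈ , u~x | no x∉A = p⊆p∪q NB (inA (∈N⁺ x∉A (p∩q⊆p A B u∈) u~x))
    ... | x∉ , u , u∈ , u~x | yes x∈A =
      q⊆p∪q NA NB (inB (∈N⁺ (λ x∈B → x∉ (x∈p∩q⁺ (x∈A , x∈B))) (p∩q⊆q A B u∈) u~x))
    D∪ : D ⊆ NA ∪ NB
    D∪ x∈D = p⊆p∪q NB (q⊆p∪q (N A) D x∈D)
    ∪⊆ : (N (A ∪ B) ∪ D) ∪ (N (A ∩ B) ∪ D) ⊆ NA ∪ NB
    ∪⊆ = ∪-lub (∪-lub N∪ D∪) (∪-lub N∩ D∪)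
    ∩⊆ : (N (A ∪ B) ∪ D) ∩ (N (A ∩ B) ∪ D) ⊆ NA ∩ NB
    ∩⊆ x∈ with x∈p∪q⁻ (N (A ∪ B)) D (p∩q⊆p _ (N (A ∩ B) ∪ D) x∈)
             | x∈p∪q⁻ (N (A ∩ B)) D (p∩q⊆q (N (A ∪ B) ∪ D) _ x∈)
    ... | inj₂ x∈D | _        = D⇒ x∈D
    ... | inj₁ _   | inj₂ x∈D = D⇒ x∈D
    ... | inj₁ x∈∪ | inj₁ x∈∩ with ∈N⁻ x∈∪ | ∈N⁻ x∈∩
    ... | x∉ , _ | _ , u , u∈ , u~x =
      x∈p∩q⁺ ( inA (∈N⁺ (x∉ ∘ p⊆p∪q B) (p∩q⊆p A B u∈) u~x)
             , inB (∈N⁺ (x∉ ∘ q⊆p∪q A B) (p∩q⊆q A B u∈) u~x))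

  N-submodular : ∀ A B → ∣ N (A ∪ B) ∣ + ∣ N (A ∩ B) ∣ ≤ ∣ N A ∣ + ∣ N B ∣
  N-submodular A B = subst id
    (cong₂ _≤_ (cong₂ _+_ (eq (A ∪ B)) (eq (A ∩ B))) (cong₂ _+_ (eq A) (eq B)))
    (N∪-submodular A B ⊥)
    where
    eq : ∀ C → ∣ N C ∪ ⊥ ∣ ≡ ∣ N C ∣
    eq C = cong ∣_∣ (∪-identityʳ (N C))

  -- The intersection does not fall below `c` and `B` does not exceed it, so submodularity leaves
  -- the union nothing to gain over `A`.
  uncross : ∀ D {A B c} → c ≤ ∣ N (A ∩ B) ∪ D ∣ → ∣ N B ∪ D ∣ ≤ c → ∣ N (A ∪ B) ∪ D ∣ ≤ ∣ N A ∪ D ∣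
  uncross D {A} {B} {c} c≤ ≤c = +-cancelʳ-≤ c _ _
    (≤-trans (+-monoʳ-≤ _ c≤) (≤-trans (N∪-submodular A B D) (+-monoʳ-≤ _ ≤c)))

  -- Labels carried by a vertex set.

  Carries : Subset order → Pred Label 0ℓ
  Carries A x = ∃[ v ] (v ∈ A × x ∈ f v)

  carries? : ∀ A → Decidable (Carries A)
  carries? A x = any? λ v → (v ∈? A) ×-dec (x ∈? f v)

  labels : Subset order → Subset #labels
  labels A = ⟦ carries? A ⟧

  labels-mono : ∀ {A B} → A ⊆ B → labels A ⊆ labels B
  labels-mono {A} {B} A⊆B x∈ =
    let v , v∈A , x∈v = ∈⟦⟧⁻ (carries? A) x∈ in ∈⟦⟧⁺ (carries? B) (v , A⊆B v∈A , x∈v)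

  labels-∪ : ∀ A B → labels (A ∪ B) ⊆ labels A ∪ labels B
  labels-∪ A B x∈ with ∈⟦⟧⁻ (carries? (A ∪ B)) x∈
  ... | v , v∈ , x∈v with x∈p∪q⁻ A B v∈
  ... | inj₁ v∈A = p⊆p∪q (labels B) (∈⟦⟧⁺ (carries? A) (v , v∈A , x∈v))
  ... | inj₂ v∈B = q⊆p∪q (labels A) (labels B) (∈⟦⟧⁺ (carries? B) (v , v∈B , x∈v))

  Avoids : List Label → Subset order → Set
  Avoids Y A = All (λ x → x ∉ labels A) Y

  avoids? : ∀ Y A → Dec (Avoids Y A)
  avoids? Y A = All.all? (λ x → ¬? (x ∈? labels A)) Y

  avoids-anti : ∀ {Y A B} → A ⊆ B → Avoids Y B → Avoids Y A
  avoids-anti A⊆B = All.map (_∘ labels-mono A⊆B)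

  avoids-∪ : ∀ {Y A B} → Avoids Y A → Avoids Y B → Avoids Y (A ∪ B)
  avoids-∪ {A = A} {B} avA avB = All.zipWith
    (λ { (x∉A , x∉B) x∈ → [ x∉A , x∉B ]′ (x∈p∪q⁻ (labels A) (labels B) (labels-∪ A B x∈)) })
    (avA , avB)

  -- Minimum cuts and the few labels that force them.

  Narrow : Subset order → ℕ → List Label → Pred (Subset order) 0ℓ
  Narrow B k Y A = B ⊆ A × Avoids Y A × ∣ N A ∣ < k

  narrow? : ∀ B k Y → Dec (∃ (Narrow B k Y))
  narrow? B k Y = anySubset? λ A → (B ⊆? A) ×-dec (avoids? Y A ×-dec (∣ N A ∣ <? k))

  -- Cuts are represented by the side A containing B, the cut itself being N A; it may contain
  -- vertices carrying labels of Y.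
  Connectivity≥ : Subset order → ℕ → List Label → Set
  Connectivity≥ B k Y = ∀ {A} → B ⊆ A → Avoids Y A → k ≤ ∣ N A ∣

  ¬narrow⇒≥ : ∀ {B k Y} → ¬ ∃ (Narrow B k Y) → Connectivity≥ B k Y
  ¬narrow⇒≥ none B⊆A av = ≮⇒≥ λ lt → none (_ , B⊆A , av , lt)

  connectivity-mono : ∀ {B B′ k Y Y′} → B ⊆ B′ → Y ⊆ˡ Y′ → Connectivity≥ B k Y → Connectivity≥ B′ k Y′
  connectivity-mono B⊆ Y⊆ big B′⊆A av = big (B′⊆A ∘ B⊆) (⊆ˡ.All-resp-⊇ Y⊆ av)

  -- If no label of `X` raises the bound, each has a set around `B` that avoids it and `Y`, with at
  -- most `k` neighbours. Such sets can be intersected: the union avoids `Y`, so it has at least `k`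
  -- neighbours, and submodularity leaves at most `k` for the intersection. Keeping `C ⊆ A` is what
  -- makes the union avoid `Y`.
  intersect : ∀ {B k Y} → Connectivity≥ B k Y → ∀ {A} → B ⊆ A → Avoids Y A → ∣ N A ∣ ≤ k → ∀ X →
              (∃[ x ] (x ∈ˡ X × Connectivity≥ B (suc k) (x ∷ Y))) ⊎
              (∃[ C ] (C ⊆ A × B ⊆ C × Avoids X C × ∣ N C ∣ ≤ k))
  intersect _ {A} B⊆A _ small [] = inj₂ (A , ⊆-refl , B⊆A , [] , small)
  intersect {B} {k} {Y} big B⊆A av small (x ∷ X) with narrow? B (suc k) (x ∷ Y)
  ... | no none = inj₁ (x , here refl , ¬narrow⇒≥ none)
  ... | yes (A′ , B⊆A′ , x∉ ∷ av′ , s≤s small′) with intersect big B⊆A av small X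
  ... | inj₁ (y , y∈ , big′) = inj₁ (y , there y∈ , big′)
  ... | inj₂ (C , C⊆A , B⊆C , avC , smallC) =
    inj₂ (A′ ∩ C , C⊆A ∘ p∩q⊆q A′ C , (λ v∈ → x∈p∩q⁺ (B⊆A′ v∈ , B⊆C v∈)) ,
          x∉ ∘ labels-mono (p∩q⊆p A′ C) ∷ avoids-anti (p∩q⊆q A′ C) avC ,
          +-cancelˡ-≤ k _ _ (begin
            k + ∣ N (A′ ∩ C) ∣                 ≤⟨ +-monoˡ-≤ _ (big (p⊆p∪q C ∘ B⊆A′) (avoids-∪ av′ (avoids-anti C⊆A av))) ⟩
            ∣ N (A′ ∪ C) ∣ + ∣ N (A′ ∩ C) ∣     ≤⟨ N-submodular A′ C ⟩
            ∣ N A′ ∣ + ∣ N C ∣                 ≤⟨ +-mono-≤ small′ smallC ⟩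
            k + k                             ∎))
    where open ≤-Reasoning

  -- If no single label raised the bound, `intersect` would give a set avoiding all of `X` with at
  -- most `k` neighbours.
  augment : ∀ {B k X Y} → Connectivity≥ B k Y → Connectivity≥ B (suc k) X →
            ∃[ zs ] (length zs ≤ 1 × zs ⊆ˡ X × Connectivity≥ B (suc k) (zs ++ Y))
  augment {B} {k} {X} {Y} bigY bigX with narrow? B (suc k) Y
  ... | no none = [] , z≤n , (λ ()) , ¬narrow⇒≥ none
  ... | yes (A , B⊆A , av , s≤s small) with intersect bigY B⊆A av small X
  ... | inj₁ (x , x∈ , big) = x ∷ [] , ≤-refl , (λ { (here refl) → x∈ }) , big
  ... | inj₂ (C , _ , B⊆C , avC , smallC) = contradiction (bigX B⊆C avC) (≤⇒≯ smallC)

  -- Each unit of connectivity costs at most one label, by `augment`.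
  basis : ∀ {B X} k → Connectivity≥ B k X → ∃[ Y ] (length Y ≤ k × Y ⊆ˡ X × Connectivity≥ B k Y)
  basis zero    _   = [] , z≤n , (λ ()) , λ _ _ → z≤n
  basis (suc k) big with basis k (λ B⊆A av → <⇒≤ (big B⊆A av))
  ... | Y , len , Y⊆ , bigY with augment bigY big
  ... | zs , len′ , zs⊆ , big′ =
    zs ++ Y , ≤-trans (≤-reflexive (length-++ zs)) (+-mono-≤ len′ len) , ++-lub zs⊆ Y⊆ , big′

  -- The sets A with N A an important separator between A and the labels in Y.
  Tight : List Label → Subset order → Set
  Tight Y A = ∀ {v} → v ∈ N A → Connectivity≥ (A ∪ ⁅ v ⁆) (suc ∣ N A ∣) Y

  -- A larger set either absorbs some `v` in `N A`, where tightness gives even more, or keeps all of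
  -- `N A` in its neighbourhood.
  tight⇒≥ : ∀ {Y A} → Tight Y A → Connectivity≥ A ∣ N A ∣ Y
  tight⇒≥ {A = A} tight {A = C} A⊆C av with any? (λ v → (v ∈? N A) ×-dec (v ∈? C))
  ... | yes (v , v∈N , v∈C) = <⇒≤ (tight v∈N (∪-lub A⊆C (⁅⁆⊆ v∈C)) av)
  ... | no  none = p⊆q⇒∣p∣≤∣q∣ λ v∈N → let _ , u , u∈A , u~v = ∈N⁻ v∈N in
    ∈N⁺ (λ v∈C → none (_ , v∈N , v∈C)) (A⊆C u∈A) u~v

  tight-witness : ∀ {X A} → Tight X A →
                  ∃[ Y ] (length Y ≤ ∣ N A ∣ + ∣ N A ∣ × Y ⊆ˡ X × Tight Y A)
  tight-witness {X} {A} tight with basis ∣ N A ∣ (tight⇒≥ tight)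
  ... | Y , len , Y⊆ , big
    with collect (N A) {λ v zs → Connectivity≥ (A ∪ ⁅ v ⁆) (suc ∣ N A ∣) (zs ++ Y)}
           -- The bound at `A` carries over to `A ∪ ⁅ v ⁆`, so each `v` needs at most one more
           -- label.
           (λ v∈ → augment (connectivity-mono (p⊆p∪q _) id big) (tight v∈))
  ... | zs , len′ , zs⊆ , found =
    zs ++ Y , ≤-trans (≤-reflexive (length-++ zs)) (+-mono-≤ len′ len) , ++-lub zs⊆ Y⊆ ,
    λ v∈ → let ys , ys⊆ , bigᵥ = found v∈ in connectivity-mono id (⊆ˡ.++⁺ ys⊆ id) bigᵥ

  -- Connected sides around a terminal.

  module _ (t : Vertex) where

    -- Reachability from `t` within `A`, phrased as an induction principle so that inclusions of
    -- connected sets need no paths.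
    Connected : Subset order → Set
    Connected A = ∀ B → t ∈ B → (∀ {u w} → u ∈ B → u ∈ A → w ∈ A → u ~ w → w ∈ B) → A ⊆ B

    component : Subset order → Subset order
    component S = ⟦ R? G t S ⟧

    component-closed : ∀ {S u w} → u ∈ component S → w ∉ S → u ~ w → w ∈ component S
    component-closed {S} u∈ w∉S u~w with ∈⟦⟧⁻ (R? G t S) u∈
    ... | t∉S , u∉S , path = ∈⟦⟧⁺ (R? G t S) (t∉S , w∉S , path ◅◅ ((u∉S , w∉S , u~w) ◅ ε))

    component-disjoint : ∀ {S v} → v ∈ component S → v ∉ S
    component-disjoint {S} v∈ = proj₁ (proj₂ (∈⟦⟧⁻ (R? G t S) v∈))

    t∈component : ∀ {S} → t ∉ S → t ∈ component S
    t∈component {S} t∉S = ∈⟦⟧⁺ (R? G t S) (t∉S , t∉S , ε)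

    component-connected : ∀ {S} → Connected (component S)
    component-connected {S} B t∈B closed v∈ with ∈⟦⟧⁻ (R? G t S) v∈
    ... | t∉S , _ , path = go t∈B (t∈component t∉S) path
      where
      go : ∀ {u v} → u ∈ B → u ∈ component S → Star (Adj∖ G S) u v → v ∈ B
      go u∈B _  ε = u∈B
      go u∈B u∈ ((u∉ , w∉ , u~w) ◅ path) =
        let w∈ = component-closed u∈ w∉ u~w in go (closed u∈B u∈ w∈ u~w) w∈ path

    N-component : ∀ {S} → N (component S) ⊆ S
    N-component {S} {v} v∈N with ∈N⁻ v∈N | v ∈? S
    ... | _              | yes v∈S = v∈S
    ... | v∉ , u , u∈ , u~v | no  v∉S = contradiction (component-closed u∈ v∉S u~v) v∉

    -- A walk from `t` inside `A` could leave `B` only through `N B`.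
    connected-⊆ : ∀ {A B} → Connected A → t ∈ B → (∀ {v} → v ∈ N B → v ∉ A) → A ⊆ B
    connected-⊆ {A} {B} conn t∈B disjoint = conn B t∈B closed
      where
      closed : ∀ {u w} → u ∈ B → u ∈ A → w ∈ A → u ~ w → w ∈ B
      closed {w = w} u∈B _ w∈A u~w with w ∈? B
      ... | yes w∈B = w∈B
      ... | no  w∉B = contradiction w∈A (disjoint (∈N⁺ w∉B u∈B u~w))

    record Candidate (m : ℕ) (X : List Label) (A : Subset order) : Set where
      field
        terminal  : t ∈ A
        connected : Connected A
        avoids    : Avoids X A
        small     : ∣ N A ∣ ≤ m
    open Candidate

    -- Where tightness fails at `v`, some `B` around `A ∪ ⁅ v ⁆` avoids `X` with no more neighbours
    -- than `A`. The component of `t` outside `N B` restores connectivity and strictly contains `A`,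
    -- so the process ends.
    tighten : ∀ {m X A} → Acc _⊃_ A → Candidate m X A →
              ∃[ A′ ] (A ⊆ A′ × Candidate m X A′ × Tight X A′)
    tighten {m} {X} {A} (acc rec) cand
      with any? (λ v → (v ∈? N A) ×-dec narrow? (A ∪ ⁅ v ⁆) (suc ∣ N A ∣) X)
    ... | no none = A , ⊆-refl , cand , λ v∈ → ¬narrow⇒≥ λ narrow → none (_ , v∈ , narrow)
    ... | yes (v , v∈N , B , Av⊆B , avB , s≤s NB≤NA) with ∈N⁻ v∈N
    ... | v∉A , u , u∈A , u~v =
      let A′ , C⊆A′ , cand′ , tight = tighten (rec (A⊆C , v , v∈C , v∉A)) candC
      in A′ , C⊆A′ ∘ A⊆C , cand′ , tight
      where
      C = component (N B)
      A⊆B : A ⊆ B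
      A⊆B = Av⊆B ∘ p⊆p∪q ⁅ v ⁆
      B∌N : ∀ {w} → w ∈ B → w ∉ N B
      B∌N w∈B w∈N = proj₁ (∈N⁻ w∈N) w∈B
      t∈C : t ∈ C
      t∈C = t∈component (B∌N (A⊆B (terminal cand)))
      A⊆C : A ⊆ C
      A⊆C = connected-⊆ (connected cand) t∈C λ w∈NC w∈A → B∌N (A⊆B w∈A) (N-component w∈NC)
      v∈C : v ∈ C
      v∈C = component-closed (A⊆C u∈A) (B∌N (Av⊆B (q⊆p∪q A ⁅ v ⁆ (x∈⁅x⁆ v)))) u~v
      C⊆B : C ⊆ B
      C⊆B = connected-⊆ component-connected (A⊆B (terminal cand)) λ w∈NB w∈C → component-disjoint w∈C w∈NB
      candC : Candidate m X C
      candC = record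
        { terminal = t∈C ; connected = component-connected ; avoids = avoids-anti C⊆B avB
        ; small = ≤-trans (p⊆q⇒∣p∣≤∣q∣ N-component) (≤-trans NB≤NA (small cand)) }

    -- Branching enumeration of important separators.

    module _ (m : ℕ) (Y : List Label) where

      -- Z is the part of the candidate already known to lie inside it, D a known part of its
      -- separator, and c a lower bound on the size of any cut compatible with Z and D.  If some
      -- B ⊇ Z ∪ {v} attains c, uncrossing with B forces v into every tight candidate; otherwise
      -- putting v inside raises c and putting v into the separator enlarges D, so that the
      -- measure 2m − ∣D∣ − c drops in both branches.
      enumerate : ∀ {Z D} μ c → Acc _⊃_ Z → Acc _⊃_ D → t ∈ Z →
                  (∀ {B} → Z ⊆ B → Avoids Y B → c ≤ ∣ N B ∪ D ∣) →
                  m + m ≤ μ + (∣ D ∣ + c) →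
                  ∃[ As ] (length As ≤ 2 ^ μ ×
                    (∀ {A} → Candidate m Y A → Tight Y A → Z ⊆ A → D ⊆ N A → A ∈ˡ As))
      enumerate {Z} {D} μ c (acc recZ) (acc recD) t∈Z c≤ fuel
        with any? (λ v → (v ∈? N Z) ×-dec ¬? (v ∈? D))
      -- Here `N Z ⊆ D ⊆ N A`, so a candidate `A` around `Z` cannot grow beyond `Z`.
      ... | no none = Z ∷ [] , m^n>0 2 μ , λ {A} cand _ Z⊆A D⊆N →
        here (⊆-antisym (connected-⊆ (connected cand) t∈Z (λ v∈NZ v∈A →
                none (_ , v∈NZ , λ v∈D → proj₁ (∈N⁻ (D⊆N v∈D)) v∈A))) Z⊆A)
      ... | yes (v , v∈NZ , v∉D) with ∈N⁻ v∈NZ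
      ... | v∉Z , u , u∈Z , u~v
        with anySubset? (λ B → (Z ∪ ⁅ v ⁆ ⊆? B) ×-dec (avoids? Y B ×-dec (∣ N B ∪ D ∣ ≤? c)))
      ... | yes (B , Zv⊆B , avB , NB≤c) =
        -- As `v` is forced, neither `μ` nor `c` changes; termination rests on the growth of `Z`.
        let As , len , complete = enumerate μ c (recZ (∪⁅⁆-⊃ v∉Z)) (acc recD) (p⊆p∪q _ t∈Z)
              (λ Zv⊆ → c≤ (Zv⊆ ∘ p⊆p∪q _)) fuel
        in As , len , λ cand tight Z⊆A D⊆N →
             complete cand tight (∪-lub Z⊆A (⁅⁆⊆ (v∈ cand tight Z⊆A D⊆N))) D⊆N
        where
        v∈B : v ∈ B
        v∈B = Zv⊆B (q⊆p∪q Z ⁅ v ⁆ (x∈⁅x⁆ v))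
        v∈ : ∀ {A} → Candidate m Y A → Tight Y A → Z ⊆ A → D ⊆ N A → v ∈ A
        v∈ {A} cand tight Z⊆A D⊆N with v ∈? A
        ... | yes v∈A = v∈A
        -- Tightness would make `N (A ∪ B)` larger than `N A`, while uncrossing bounds it by the
        -- size of `N A ∪ D`, which is `N A`.
        ... | no  v∉A = contradiction
          (≤-trans (tight (∈N⁺ v∉A (Z⊆A u∈Z) u~v) (∪-lub (p⊆p∪q B) (⁅⁆⊆ (q⊆p∪q A B v∈B)))
                      (avoids-∪ (avoids cand) avB))
             (≤-trans (∣p∣≤∣p∪q∣ (N (A ∪ B)) D)
               (≤-trans (uncross D (c≤ (λ z∈ → x∈p∩q⁺ (Z⊆A z∈ , Zv⊆B (p⊆p∪q _ z∈)))
                                       (avoids-anti (p∩q⊆p A B) (avoids cand))) NB≤c)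
                 (p⊆q⇒∣p∣≤∣q∣ (∪-lub ⊆-refl D⊆N)))))
          1+n≰n
      enumerate {Z} {D} μ c (acc recZ) (acc recD) t∈Z c≤ fuel
          | yes (v , v∈NZ , v∉D) | v∉Z , u , u∈Z , u~v | no none = branch μ fuel
        where
        c< : ∀ {B} → Z ∪ ⁅ v ⁆ ⊆ B → Avoids Y B → suc c ≤ ∣ N B ∪ D ∣
        c< Zv⊆B avB = ≰⇒> λ ≤c → none (_ , Zv⊆B , avB , ≤c)
        D<Dv : ∣ D ∣ < ∣ D ∪ ⁅ v ⁆ ∣
        D<Dv = p⊂q⇒∣p∣<∣q∣ (∪⁅⁆-⊃ v∉D)
        c≤Dv : ∀ {B} → Z ⊆ B → Avoids Y B → c ≤ ∣ N B ∪ (D ∪ ⁅ v ⁆) ∣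
        c≤Dv {B} Z⊆B avB = ≤-trans (c≤ Z⊆B avB)
          (p⊆q⇒∣p∣≤∣q∣ {p = N B ∪ D} (∪-lub (p⊆p∪q _) (q⊆p∪q (N B) (D ∪ ⁅ v ⁆) ∘ p⊆p∪q ⁅ v ⁆)))
        branch : ∀ μ → m + m ≤ μ + (∣ D ∣ + c) →
                 ∃[ As ] (length As ≤ 2 ^ μ ×
                   (∀ {A} → Candidate m Y A → Tight Y A → Z ⊆ A → D ⊆ N A → A ∈ˡ As))
        -- Without budget `∣ D ∣ + c` is at least `m + m`. A candidate bounds both terms by `m`, one
        -- of them strictly: `c` if `v` lies in `A`, `∣ D ∣` otherwise.
        branch zero fuel = [] , z≤n , λ {A} cand tight Z⊆A D⊆N → ⊥-elim (absurd cand Z⊆A D⊆N)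
          where
          absurd : ∀ {A} → Candidate m Y A → Z ⊆ A → D ⊆ N A → Empty
          absurd {A} cand Z⊆A D⊆N with v ∈? A
          ... | yes v∈A = <⇒≱ (+-mono-≤-< (≤-trans (p⊆q⇒∣p∣≤∣q∣ D⊆N) (small cand))
            (≤-trans (c< (∪-lub Z⊆A (⁅⁆⊆ v∈A)) (avoids cand))
              (≤-trans (p⊆q⇒∣p∣≤∣q∣ (∪-lub ⊆-refl D⊆N)) (small cand)))) fuel
          ... | no  v∉A = <⇒≱ (+-mono-<-≤
            (≤-trans D<Dv (≤-trans
              (p⊆q⇒∣p∣≤∣q∣ (∪-lub D⊆N (⁅⁆⊆ (∈N⁺ v∉A (Z⊆A u∈Z) u~v)))) (small cand)))
            (≤-trans (c≤ Z⊆A (avoids cand))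
              (≤-trans (p⊆q⇒∣p∣≤∣q∣ (∪-lub ⊆-refl D⊆N)) (small cand)))) fuel
        branch (suc μ) fuel
          with enumerate {Z ∪ ⁅ v ⁆} {D} μ (suc c) (recZ (∪⁅⁆-⊃ v∉Z)) (acc recD) (p⊆p∪q _ t∈Z) c<
                 (≤-trans fuel (≤-reflexive (trans (sym (+-suc μ _)) (cong (μ +_) (sym (+-suc _ c))))))
             | enumerate {Z} {D ∪ ⁅ v ⁆} μ c (acc recZ) (recD (∪⁅⁆-⊃ v∉D)) t∈Z c≤Dv
                 (≤-trans fuel (≤-trans (≤-reflexive (sym (+-suc μ _)))
                   (+-monoʳ-≤ μ (+-monoˡ-≤ c D<Dv))))
        ... | As , lenA , completeA | Bs , lenB , completeB =
          As ++ Bs ,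
          ≤-trans (≤-reflexive (length-++ As)) (+-mono-≤ lenA (≤-trans lenB (m≤m+n _ 0))) ,
          complete
          where
          complete : ∀ {A} → Candidate m Y A → Tight Y A → Z ⊆ A → D ⊆ N A → A ∈ˡ As ++ Bs
          complete {A} cand tight Z⊆A D⊆N with v ∈? A
          ... | yes v∈A = ∈-++⁺ˡ (completeA cand tight (∪-lub Z⊆A (⁅⁆⊆ v∈A)) D⊆N)
          ... | no  v∉A = ∈-++⁺ʳ As (completeB cand tight Z⊆A
            (∪-lub D⊆N (⁅⁆⊆ (∈N⁺ v∉A (Z⊆A u∈Z) u~v))))

    important : ∀ {m} → 1 ≤ m → ∀ Y → ∃[ As ] (length As ≤ 2 ^ (m + m ∸ 1) ×
                (∀ {A v} → Candidate m Y A → Tight Y A → v ∈ N A → A ∈ˡ As))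
    important {m} 1≤m Y with narrow? ⁅ t ⁆ 1 Y
    -- Having no neighbours, `B` contains `A` and then `v`, whereas tightness would make `N B`
    -- nonempty.
    ... | yes (B , t⊆B , avB , s≤s NB≤0) =
      [] , z≤n , λ cand tight v∈N → contradiction (cut cand tight v∈N) 1+n≰n
      where
      cut : ∀ {A v} → Candidate m Y A → Tight Y A → v ∈ N A → suc ∣ N A ∣ ≤ ∣ N A ∣
      cut {A} {v} cand tight v∈N = ≤-trans
        (tight v∈N (∪-lub A⊆B (⁅⁆⊆ v∈B)) avB) (≤-trans NB≤0 z≤n)
        where
        ∉NB : ∀ {w} → w ∉ N B
        ∉NB {w} w∈ = contradiction
          (≤-trans (≤-reflexive (sym (∣⁅x⁆∣≡1 w))) (≤-trans (p⊆q⇒∣p∣≤∣q∣ (⁅⁆⊆ w∈)) NB≤0)) λ ()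
        A⊆B : A ⊆ B
        A⊆B = connected-⊆ (connected cand) (t⊆B (x∈⁅x⁆ t)) λ w∈ → contradiction w∈ ∉NB
        v∈B : v ∈ B
        v∈B with v ∈? B | ∈N⁻ v∈N
        ... | yes v∈B | _ = v∈B
        ... | no  v∉B | _ , u , u∈A , u~v = contradiction (∈N⁺ v∉B (A⊆B u∈A) u~v) ∉NB
    ... | no none =
      -- Every cut now has a vertex, so the search starts at `c = 1` with budget `m + m ∸ 1`. The
      -- factor 2 saved pays later for the two extra label sets.
      let As , len , complete = enumerate m Y {⁅ t ⁆} {⊥} (m + m ∸ 1) 1
            (⊃-wellFounded _) (⊃-wellFounded _) (x∈⁅x⁆ t)
            (λ {B} t⊆B avB → ≤-trans (¬narrow⇒≥ none t⊆B avB) (∣p∣≤∣p∪q∣ (N B) ⊥))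
            (≤-reflexive (sym (trans (cong (λ d → m + m ∸ 1 + (d + 1)) (∣⊥∣≡0 order))
              (m∸n+n≡m (≤-trans 1≤m (m≤m+n m m))))))
      in As , len , λ cand tight _ → complete cand tight (⁅⁆⊆ (terminal cand)) (⊥-elim ∘ ∉⊥)

    -- Label sets reachable from one terminal.

    ℒ⊆labels : ∀ S → ℒ G t S ⊆ labels (component S)
    ℒ⊆labels S x∈ =
      let v , r , x∈v = ∈⟦⟧⁻ (λ x → any? λ v → R? G t S v ×-dec (x ∈? f v)) x∈
      in ∈⟦⟧⁺ (carries? (component S)) (v , ∈⟦⟧⁺ (R? G t S) r , x∈v)

    labels⊆ℒ : ∀ S → labels (component S) ⊆ ℒ G t S
    labels⊆ℒ S x∈ =
      let v , v∈ , x∈v = ∈⟦⟧⁻ (carries? (component S)) x∈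
      in ∈⟦⟧⁺ (λ x → any? λ v → R? G t S v ×-dec (x ∈? f v)) (v , ∈⟦⟧⁻ (R? G t S) v∈ , x∈v)

    ℒ-deleted : ∀ {S} → t ∈ S → ℒ G t S ≡ ⊥
    ℒ-deleted {S} t∈S = ⊆-antisym
      (λ x∈ → let _ , v∈ , _ = ∈⟦⟧⁻ (carries? (component S)) (ℒ⊆labels S x∈)
              in contradiction t∈S (proj₁ (∈⟦⟧⁻ (R? G t S) v∈)))
      (⊥-elim ∘ ∉⊥)

    module _ {m} (1≤m : 1 ≤ m) where

      fromLabels : Vec Label (m + m) → List (Subset #labels)
      fromLabels Y = List.map labels (proj₁ (important 1≤m (toList Y)))

      -- ⊥ accounts for t ∈ S and labels (component ⊥) for an S that separates nothing from t.
      labelSets : List (Subset #labels)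
      labelSets = ⊥ ∷ labels (component ⊥) ∷ concatMap fromLabels (vecs (allFin #labels) (m + m))

      length-labelSets : length labelSets ≤ 2 + #labels ^ (m + m) * 2 ^ (m + m ∸ 1)
      length-labelSets = +-monoʳ-≤ 2 (≤-trans
        (length-concatMap-≤ fromLabels
          (λ Y → ≤-trans (≤-reflexive (length-map labels (proj₁ (important 1≤m (toList Y)))))
                         (proj₁ (proj₂ (important 1≤m (toList Y)))))
          (vecs (allFin #labels) (m + m)))
        (≤-reflexive (cong (_* _) (trans (length-vecs (allFin #labels) (m + m))
          (cong (_^ (m + m)) (length-tabulate id))))))

      -- If `N A` is empty, `A` is the whole component of `t`. Otherwise `A` is tight for some
      -- `m + m` labels of `X`, repetitions allowed, and the enumeration for these finds it.
      labels∈labelSets : ∀ {X A} → Candidate m X A → Tight X A → labels A ∈ˡ labelSets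
      labels∈labelSets {X} {A} cand tight with any? (λ v → v ∈? N A)
      ... | no none = there (here (cong labels (⊆-antisym
        (connected-⊆ (connected cand) (t∈component ∉⊥) (λ w∈ _ → ∉⊥ (N-component w∈)))
        (connected-⊆ component-connected (terminal cand) (λ w∈ _ → none (_ , w∈))))))
      ... | yes (v , v∈N) with tight-witness tight
      -- The set of all vertices avoids an empty witness and has no neighbours. Hence there is a
      -- first label to pad with.
      ... | [] , _ , _ , tight′ = contradiction
        (≤-trans (tight′ v∈N {A = ⊤} (λ _ → ∈⊤) []) (≤-trans (≤-reflexive N⊤) z≤n)) 1+n≰n
        where
        N⊤ : ∣ N ⊤ ∣ ≡ 0
        N⊤ = trans (cong ∣_∣ (⊆-antisym {j = ⊥} (λ w∈ → contradiction ∈⊤ (proj₁ (∈N⁻ w∈))) (⊥-elim ∘ ∉⊥)))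
                   (∣⊥∣≡0 order)
      ... | Y@(_ ∷ _) , len , Y⊆X , tight′
        with pad (Y⊆X (here refl)) (m + m) Y Y⊆X (≤-trans len (+-mono-≤ (small cand) (small cand)))
      ... | V , Y⊆V , V⊆X = there (there (∈-concatMap⁺ fromLabels
        (Any.map (λ { refl → ∈-map⁺ labels (proj₂ (proj₂ (important 1≤m (toList V))) candV tightV v∈N) })
          (vecs-complete ∈-allFin V))))
        where
        candV : Candidate m (toList V) A
        candV = record { terminal = terminal cand ; connected = connected cand
                       ; avoids = ⊆ˡ.All-resp-⊇ V⊆X (avoids cand) ; small = small cand }
        tightV : Tight (toList V) A
        tightV w∈ = connectivity-mono id Y⊆V (tight′ w∈)

      -- With `X` the labels cut off by `S`, tightening enlarges the component, so no label is lost,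
      -- and it still avoids `X`, so none is gained.
      ℒ∈labelSets : ∀ S → ∣ S ∣ ≤ m → ℒ G t S ∈ˡ labelSets
      ℒ∈labelSets S S≤m = case t ∈? S of λ where
          (yes t∈S) → here (ℒ-deleted t∈S)
          (no  t∉S) → let A , S⊆A , candA , tight = tighten (⊃-wellFounded _) (cand t∉S) in
            subst (_∈ˡ labelSets) (⊆-antisym (labels⊆ candA) (labels-mono S⊆A ∘ ℒ⊆labels S))
              (labels∈labelSets candA tight)
        where
        unseen? : Decidable (_∉ ℒ G t S)
        unseen? x = ¬? (x ∈? ℒ G t S)
        X = filter unseen? (allFin #labels)
        cand : t ∉ S → Candidate m X (component S)
        cand t∉S = record
          { terminal  = t∈component t∉S
          ; connected = component-connected
          ; avoids    = All.map (_∘ labels⊆ℒ S) (all-filter unseen? (allFin #labels))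
          ; small     = ≤-trans (p⊆q⇒∣p∣≤∣q∣ N-component) S≤m }
        labels⊆ : ∀ {A} → Candidate m X A → labels A ⊆ ℒ G t S
        labels⊆ candA {x} x∈ = decidable-stable (x ∈? ℒ G t S) λ x∉ℒ →
          All.lookup (avoids candA) (∈-filter⁺ unseen? (∈-allFin x) x∉ℒ) x∈

  -- Product over the terminals.

  characteristics : ∀ {m n} → 1 ≤ m → Vec Vertex n → List (Vec (Subset #labels) n)
  characteristics 1≤m []      = [] ∷ []
  characteristics 1≤m (t ∷ T) = cartesianProductWith _∷_ (labelSets t 1≤m) (characteristics 1≤m T)

  length-characteristics : ∀ {m n} (1≤m : 1 ≤ m) (T : Vec Vertex n) →
    length (characteristics 1≤m T) ≤ (2 + #labels ^ (m + m) * 2 ^ (m + m ∸ 1)) ^ n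
  length-characteristics 1≤m []      = ≤-refl
  length-characteristics 1≤m (t ∷ T) =
    ≤-trans (≤-reflexive (length-cpw _∷_ (labelSets t 1≤m) (characteristics 1≤m T)))
      (*-mono-≤ (length-labelSets t 1≤m) (length-characteristics 1≤m T))

  𝒦∈characteristics : ∀ {m n} (1≤m : 1 ≤ m) (T : Vec Vertex n) S → ∣ S ∣ ≤ m →
                      𝒦 G S T ∈ˡ characteristics 1≤m T
  𝒦∈characteristics 1≤m []      S S≤m = here refl
  𝒦∈characteristics 1≤m (t ∷ T) S S≤m =
    ∈-cartesianProductWith⁺ _∷_ (ℒ∈labelSets t 1≤m S S≤m) (𝒦∈characteristics 1≤m T S S≤m)

-- Comparison with the stated bound.

^-distribʳ-* : ∀ k a b → (a * b) ^ k ≡ a ^ k * b ^ k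
^-distribʳ-* zero    a b = refl
^-distribʳ-* (suc k) a b = trans (cong (a * b *_) (^-distribʳ-* k a b))
  (solve 4 (λ a b p q → a :* b :* (p :* q) := a :* p :* (b :* q)) refl a b (a ^ k) (b ^ k))
  where open +-*-Solver

-- As `2 ≤ 2 ^ (m + m ∸ 1)`, the two extra sets at most double the main term, and doubling turns
-- this power into `4 ^ m`.
terminal-bound : ∀ {l r} m → 1 ≤ m → 1 ≤ r → l ≤ r →
                 2 + l ^ (m + m) * 2 ^ (m + m ∸ 1) ≤ r ^ (m + m) * 4 ^ m
terminal-bound {l} {r} (suc m) 1≤m 1≤r l≤r = begin
  2 + l ^ (k + k) * q       ≤⟨ +-mono-≤ 2≤q (*-monoˡ-≤ q (^-monoˡ-≤ (k + k) l≤r)) ⟩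
  q + P * q                 ≤⟨ +-monoˡ-≤ (P * q) (m≤n*m q P {{m^n≢0 r (k + k) {{>-nonZero 1≤r}}}}) ⟩
  P * q + P * q             ≡⟨ *-distribˡ-+ P q q ⟨
  P * (q + q)               ≡⟨ cong (λ z → P * (q + z)) (+-identityʳ q) ⟨
  P * 2 ^ (k + k)           ≡⟨ cong (P *_) (trans (^-distribˡ-+-* 2 k k) (sym (^-distribʳ-* k 2 2))) ⟩
  P * 4 ^ k                 ∎
  where
  open ≤-Reasoning
  k = suc m
  q = 2 ^ (m + k)
  P = r ^ (k + k)
  2≤q : 2 ≤ q
  2≤q = ^-monoʳ-≤ 2 (≤-trans (s≤s z≤n) (m≤n+m k m))

-- Rests on `4 ≤ m + 3`; equality holds at `m = 1`.
exponent-bound : ∀ n m → 1 ≤ m → (m + m) * n ≤ n * m * (m + 3) / 2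
exponent-bound n m 1≤m = begin
  (m + m) * n          ≡⟨ m*n/n≡m ((m + m) * n) 2 ⟨
  (m + m) * n * 2 / 2  ≡⟨ cong (_/ 2) (solve 2 (λ n m → (m :+ m) :* n :* con 2 := n :* m :* (con 4)) refl n m) ⟩
  n * m * 4 / 2        ≤⟨ /-monoˡ-≤ 2 (*-monoʳ-≤ (n * m) (+-monoˡ-≤ 3 1≤m)) ⟩
  n * m * (m + 3) / 2  ∎
  where
  open ≤-Reasoning
  open +-*-Solver

count-≤-κ-bound : ∀ {n m r c} → 1 ≤ m → 1 ≤ r → CharacteristicCount n m r c → c ≤ κ-bound n m r
count-≤-κ-bound {n} {m} {r} 1≤m 1≤r (G , l≤r , T , _ , xs , unique , spec , refl) = begin
  length xs                       ≤⟨ unique-⊆⇒length-≤ unique xs⊆ ⟩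
  length (characteristics G 1≤m T) ≤⟨ length-characteristics G 1≤m T ⟩
  (2 + l ^ (m + m) * 2 ^ (m + m ∸ 1)) ^ n ≤⟨ ^-monoˡ-≤ n (terminal-bound m 1≤m 1≤r l≤r) ⟩
  (r ^ (m + m) * 4 ^ m) ^ n       ≡⟨ ^-distribʳ-* n (r ^ (m + m)) (4 ^ m) ⟩
  (r ^ (m + m)) ^ n * (4 ^ m) ^ n ≡⟨ cong₂ _*_ (^-*-assoc r (m + m) n) (^-*-assoc 4 m n) ⟩
  r ^ ((m + m) * n) * 4 ^ (m * n) ≤⟨ *-mono-≤ (^-monoʳ-≤ r {{>-nonZero 1≤r}} (exponent-bound n m 1≤m))
                                              (≤-reflexive (cong (4 ^_) (*-comm m n))) ⟩
  r ^ E * 4 ^ (n * m)             ≤⟨ *-monoˡ-≤ (4 ^ (n * m)) (m≤n*m (r ^ E) (m ^ (2 * n)) {{m^n≢0 m (2 * n) {{>-nonZero 1≤m}}}}) ⟩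
  m ^ (2 * n) * r ^ E * 4 ^ (n * m) ∎
  where
  open ≤-Reasoning
  l = LabeledGraph.#labels G
  E = n * m * (m + 3) / 2
  xs⊆ : xs ⊆ˡ characteristics G 1≤m T
  xs⊆ {χ} χ∈ with Equivalence.to (spec χ) χ∈
  ... | S , S≤m , refl = 𝒦∈characteristics G 1≤m T S S≤m

-- Polynomiality in `r`, and the conclusion.

evalPoly-monomial : ∀ a e x → a * x ^ e ≡ evalPoly (replicate e 0 ++ a ∷ []) x
evalPoly-monomial a zero    x =
  trans (*-identityʳ a) (sym (trans (cong (a +_) (*-zeroʳ x)) (+-identityʳ a)))
evalPoly-monomial a (suc e) x =
  trans (solve 3 (λ a x y → a :* (x :* y) := x :* (a :* y)) refl a x (x ^ e))
        (cong (x *_) (evalPoly-monomial a e x))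
  where open +-*-Solver

theorem1 : (∃[ C ] (∀ n m r k → 1 ≤ m → 1 ≤ r → κ n m r k → k ≤ C * κ-bound n m r)) ×
    (∀ n m → IsPolynomial (λ r → κ-bound n m r))
theorem1 =
  -- The constant 1 suffices, as every count already lies below `κ-bound`.
  (1 , λ n m r k 1≤m 1≤r (count , _) →
         ≤-trans (count-≤-κ-bound 1≤m 1≤r count) (≤-reflexive (sym (*-identityˡ _)))) ,
  λ n m → let a = m ^ (2 * n) ; b = 4 ^ (n * m) ; e = n * m * (m + 3) / 2 in
    replicate e 0 ++ a * b ∷ [] , λ r →
      trans (solve 3 (λ a p b → a :* p :* b := a :* b :* p) refl a (r ^ e) b)
            (evalPoly-monomial (a * b) e r)
  where open +-*-Solver
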